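{- Let $G$ be a distance-regular graph of diameter $d$ admitting a distance magic labeling $l$. If $D$ is a non-empty subset of $\{0,1,\dots,d\}$, then $l$ is either a $D$-magic labeling or an $(\alpha,\delta)$-$D$-antimagic labeling of $G$ for some $\alpha,\delta$. Moreover, if $G$ is bipartite, then $l$ is a $D$-magic labeling for every non-empty $D\subseteq\{1,3,5,\dots\}$.
   Context: A connected graph $G$ of diameter $d$ is distance-regular if there are non-negative integers $b_i,c_i$ ($0\le i\le d$) such that for any two vertices $x,y$ at distance $i$, $y$ has exactly $c_i$ neighbours at distance $i-1$ from $x$ and exactly $b_i$ neighbours at distance $i+1$ from $x$. $G_i(x)$ is the set of vertices at distance $i$ from $x$, and for a set of distances $D$, $N_D(x)=\bigcup_{i\in D}G_i(x)$. For $G$ of order $N$ and a bijection $f:V(G)\to\{1,\dots,N\}$, the weight of $x$ is $w(x)=\sum_{y\in N_D(x)}f(y)$. $f$ is $D$-magic if $w(x)$ is constant; it is $(\alpha,\delta)$-$D$-antimagic if the weights are pairwise distinct and the set $\{w(x):x\in V(G)\}$ is an arithmetic progression starting at $\alpha$ with common difference $\delta>0$. A distance magic labeling is a $\{1\}$-magic labeling. -}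

module Defs where

open import Level using (0ℓ)
open import Data.Bool using (Bool)
open import Data.Nat using (ℕ; zero; suc; _+_; _*_; _≤_; _>_; z≤n; s≤s)
open import Data.Nat.Properties using (_≟_)
open import Data.Fin using (Fin; toℕ)
open import Data.Fin.Properties using (any?) renaming (_≟_ to _≟ᶠ_)
open import Data.List using (List; length; filter; map; allFin)
open import Data.Nat.ListAction using (sum)
open import Data.Product using (Σ; ∃; ∃-syntax; _×_; _,_; proj₁)
open import Function.Bundles using (_⤖_; _⇔_; Bijection)
open import Function.Definitions using (Injective)
open import Relation.Binary using (Rel; Symmetric)
open import Relation.Binary.PropositionalEquality using (_≡_; _≢_; refl)
import Relation.Binary as B
open import Relation.Nullary using (¬_; Dec; yes; no; contradiction; _×-dec_)
open import Relation.Nullary.Decidable using (map′)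
open import Relation.Unary using (Pred; Decidable; ｛_｝)

least : (P : Pred ℕ 0ℓ) → Decidable P → ∀ n → P n →
        ∃[ m ] (P m × (∀ j → P j → m ≤ j))
least P P? zero    p = zero , p , λ _ _ → z≤n
least P P? (suc n) p with P? zero
... | yes p₀ = zero , p₀ , λ _ _ → z≤n
... | no ¬p₀ with least (λ k → P (suc k)) (λ k → P? (suc k)) n p
... | m , pm , min = suc m , pm , λ
        { zero    p₀ → contradiction p₀ ¬p₀
        ; (suc j) pj → s≤s (min j pj) }

elements : ∀ {N} {P : Pred (Fin N) 0ℓ} → Decidable P → List (Fin N)
elements {N} P? = filter P? (allFin N)

card : ∀ {N} {P : Pred (Fin N) 0ℓ} → Decidable P → ℕ
card P? = length (elements P?)

record Graph (N : ℕ) : Set₁ where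
  field
    Adj       : Rel (Fin N) 0ℓ
    Adj?      : B.Decidable Adj
    symmetric : Symmetric Adj
    loopless  : ∀ {x} → ¬ Adj x x

  data Walk : Fin N → Fin N → ℕ → Set where
    []  : ∀ {x} → Walk x x zero
    _∷_ : ∀ {x y z n} → Adj x y → Walk y z n → Walk x z (suc n)

  walk? : ∀ x y → Decidable (Walk x y)
  walk? x y zero = map′ (λ { refl → [] }) (λ { [] → refl }) (x ≟ᶠ y)
  walk? x y (suc n) =
    map′ (λ { (_ , a , w) → a ∷ w }) (λ { (a ∷ w) → _ , a , w })
         (any? (λ z → Adj? x z ×-dec walk? z y n))

  Bipartite : Set
  Bipartite = Σ (Fin N → Bool) λ side → ∀ {x y} → Adj x y → side x ≢ side y

record ConnectedGraph (N : ℕ) : Set₁ where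
  field
    graph     : Graph N
  open Graph graph public
  field
    connected : ∀ x y → ∃ (Walk x y)

  dist : Fin N → Fin N → ℕ
  dist x y = let n , w = connected x y in proj₁ (least (Walk x y) (walk? x y) n w)

  HasDiameter : ℕ → Set
  HasDiameter d = (∀ x y → dist x y ≤ d) × (∃[ x ] ∃[ y ] dist x y ≡ d)

  -- "distance i − 1" is written suc (dist x z) ≡ i, so that for i = 0 it
  -- describes no vertex at all.
  DistanceRegular : ℕ → Set
  DistanceRegular d = HasDiameter d ×
    (Σ (Fin (suc d) → ℕ) λ b → Σ (Fin (suc d) → ℕ) λ c →
      ∀ i x y → dist x y ≡ toℕ i →
        (card (λ z → Adj? y z ×-dec (suc (dist x z) ≟ toℕ i)) ≡ c i) ×
        (card (λ z → Adj? y z ×-dec (dist x z ≟ suc (toℕ i))) ≡ b i))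

  Sphere : ℕ → Fin N → Pred (Fin N) 0ℓ
  Sphere i x y = dist x y ≡ i

  Nbhd : Pred ℕ 0ℓ → Fin N → Pred (Fin N) 0ℓ
  Nbhd D x y = ∃[ i ] (D i × Sphere i x y)

  nbhd? : ∀ {D} → Decidable D → ∀ x → Decidable (Nbhd D x)
  nbhd? D? x y =
    map′ (λ p → _ , p , refl) (λ { (_ , p , refl) → p }) (D? (dist x y))

-- The bijection V → {1, …, N}, with {1, …, N} presented as suc ∘ toℕ on Fin N.
Labeling : ℕ → Set
Labeling N = Fin N ⤖ Fin N

label : ∀ {N} → Labeling N → Fin N → ℕ
label f x = suc (toℕ (Bijection.to f x))

module _ {N : ℕ} (G : ConnectedGraph N) (f : Labeling N) where
  open ConnectedGraph G

  weight : {D : Pred ℕ 0ℓ} → Decidable D → Fin N → ℕ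
  weight D? x = sum (map (label f) (elements (nbhd? D? x)))

  Magic : {D : Pred ℕ 0ℓ} → Decidable D → Set
  Magic D? = ∃[ k ] (∀ x → weight D? x ≡ k)

  -- The progression has N terms because the N weights are pairwise distinct.
  Antimagic : ℕ → ℕ → {D : Pred ℕ 0ℓ} → Decidable D → Set
  Antimagic α δ D? =
    δ > 0 ×
    Injective _≡_ _≡_ (weight D?) ×
    (∀ v → (∃[ x ] weight D? x ≡ v) ⇔ (Σ (Fin N) λ i → v ≡ α + toℕ i * δ))

  DistanceMagic : Set
  DistanceMagic = Magic {｛ 1 ｝} (1 ≟_)

Odd : Pred ℕ 0ℓ
Odd i = ∃[ k ] i ≡ 1 + 2 * k

{-# OPTIONS --safe #-}

-- Let w i x be the sum of the labels at distance i from x, A the adjacency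
-- operator and L the labeling.  Distance-regularity gives
--   A (w (i + 1)) = b i * w i + a (i + 1) * w (i + 1) + c (i + 2) * w (i + 2),
-- and A maps every function p * L + q to a constant, because L is distance magic
-- and the graph is regular.  Starting from w 0 = L and w 1 constant, every w i is
-- of the form p * L + q, hence so is the D-weight, a sum of the w i over D: it is
-- constant if p = 0, and otherwise takes the values of an arithmetic progression
-- with difference |p|, in reverse order if p < 0.  In a bipartite graph a = 0, so
-- the recurrence links w (i + 2) to w i modulo constants, and w 1, w 3, … are
-- all constant.
module Submission where

open import Level using (0ℓ)
import Algebra.Properties.Semiring.Sum
open import Data.Bool using (Bool; not; if_then_else_)
open import Data.Bool.Properties using (¬-not)
open import Data.Fin using (Fin; zero; suc; toℕ; fromℕ<; opposite)
open import Data.Fin.Properties using (toℕ-injective; toℕ-fromℕ<; toℕ<n; opposite-prop; opposite-involutive) renaming (_≟_ to _≟ᶠ_)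
open import Data.Integer using (ℤ; +_; +[1+_]; -[1+_]; -_; _+_; _-_; _*_; 0ℤ; 1ℤ; ≢-nonZero)
import Data.Integer.Properties as ℤ
open import Data.Integer.Tactic.RingSolver using (solve-∀)
open import Data.List using (List; []; _∷_; length; filter; map; tabulate)
open import Data.List.Membership.Propositional.Properties using (∈-filter⁺; ∈-allFin)
open import Data.Nat using (ℕ; zero; suc; _≤_; s≤s; z≤n) renaming (_+_ to _+ⁿ_; _*_ to _*ⁿ_)
open import Data.Nat.DivMod using (_mod_; m<n⇒m%n≡m; m%n<n)
open import Data.Nat.ListAction using (sum)
open import Data.Nat.Properties as ℕ using (_≟_)
open import Data.Product using (∃-syntax; _×_; _,_; proj₁; proj₂)
open import Data.Sum using (_⊎_; inj₁; inj₂)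
open import Function using (_∘_)
open import Function.Bundles using (Bijection; mk⇔)
open import Function.Definitions using (Injective; StrictlySurjective)
open import Relation.Binary.PropositionalEquality using (_≡_; _≢_; refl; sym; trans; cong; cong₂; subst; module ≡-Reasoning)
open import Relation.Nullary using (¬_; Dec; yes; no; does; contradiction; _×-dec_)
open import Relation.Unary using (Pred; Decidable; Satisfiable; _⊆_)
open import Defs

open Algebra.Properties.Semiring.Sum ℤ.+-*-semiring using (sum-cong-≗; ∑-distrib-+; ∑-comm; *-distribˡ-sum; *-distribʳ-sum; sum-replicate-zero; sum-syntax)
open ≡-Reasoning

-- Indicators of decidable propositions and finite integer sums.

⟦_⟧ : {A : Set} → Dec A → ℤ
⟦ A? ⟧ = if does A? then 1ℤ else 0ℤ

module _ {A : Set} where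

  ⟦⟧-yes : (A? : Dec A) → A → ⟦ A? ⟧ ≡ 1ℤ
  ⟦⟧-yes (yes _) _ = refl
  ⟦⟧-yes (no ¬a) a = contradiction a ¬a

  ⟦⟧-no : (A? : Dec A) → ¬ A → ⟦ A? ⟧ ≡ 0ℤ
  ⟦⟧-no (yes a) ¬a = contradiction a ¬a
  ⟦⟧-no (no _)  _  = refl

  -- Under the factor `⟦ A? ⟧` an equation is only needed where `A` holds; this restricts summands
  -- to the neighbours of a vertex or to one distance.
  ⟦⟧*-cong : (A? : Dec A) {p q : ℤ} → (A → p ≡ q) → ⟦ A? ⟧ * p ≡ ⟦ A? ⟧ * q
  ⟦⟧*-cong (yes a) p≡q = cong (1ℤ *_) (p≡q a)
  ⟦⟧*-cong (no _)  _   = refl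

⟦⟧-cong : {A B : Set} (A? : Dec A) (B? : Dec B) → (A → B) → (B → A) → ⟦ A? ⟧ ≡ ⟦ B? ⟧
⟦⟧-cong (yes a) B? f g = sym (⟦⟧-yes B? (f a))
⟦⟧-cong (no ¬a) B? f g = sym (⟦⟧-no B? (¬a ∘ g))

⟦⟧-× : {A B : Set} (A? : Dec A) (B? : Dec B) → ⟦ A? ×-dec B? ⟧ ≡ ⟦ A? ⟧ * ⟦ B? ⟧
⟦⟧-× (yes _) (yes _) = refl
⟦⟧-× (yes _) (no _)  = refl
⟦⟧-× (no _)  _       = refl

∑-zero : ∀ {n} (f : Fin n → ℤ) → (∀ i → f i ≡ 0ℤ) → ∑[ i < n ] f i ≡ 0ℤ
∑-zero {n} f f≡0 = trans (sum-cong-≗ f≡0) (sum-replicate-zero n)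

∑-δ : ∀ {n} (j : Fin n) (f : Fin n → ℤ) → ∑[ i < n ] (⟦ j ≟ᶠ i ⟧ * f i) ≡ f j
∑-δ {suc n} zero f = begin
  1ℤ * f zero + ∑[ i < n ] 0ℤ  ≡⟨ cong (λ s → 1ℤ * f zero + s) (∑-zero {n} (λ _ → 0ℤ) (λ _ → refl)) ⟩
  1ℤ * f zero + 0ℤ             ≡⟨ ℤ.+-identityʳ _ ⟩
  1ℤ * f zero                  ≡⟨ ℤ.*-identityˡ _ ⟩
  f zero                       ∎
∑-δ (suc j) f = trans (ℤ.+-identityˡ _) (∑-δ j (f ∘ suc))

∑-linear₂ : ∀ {n} (α β : ℤ) (f g : Fin n → ℤ) →
  ∑[ i < n ] (α * f i + β * g i) ≡ α * ∑[ i < n ] f i + β * ∑[ i < n ] g i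
∑-linear₂ {n} α β f g = begin
  ∑[ i < n ] (α * f i + β * g i)             ≡⟨ ∑-distrib-+ (λ i → α * f i) (λ i → β * g i) ⟩
  ∑[ i < n ] (α * f i) + ∑[ i < n ] (β * g i) ≡⟨ cong₂ _+_ (*-distribˡ-sum α f) (*-distribˡ-sum β g) ⟨
  α * ∑[ i < n ] f i + β * ∑[ i < n ] g i     ∎

∑-linear₃ : ∀ {n} (α β γ : ℤ) (f g h : Fin n → ℤ) →
  ∑[ i < n ] (α * f i + β * g i + γ * h i) ≡
  α * ∑[ i < n ] f i + β * ∑[ i < n ] g i + γ * ∑[ i < n ] h i
∑-linear₃ α β γ f g h =
  trans (∑-distrib-+ (λ i → α * f i + β * g i) (λ i → γ * h i))
        (cong₂ _+_ (∑-linear₂ α β f g) (sym (*-distribˡ-sum γ h)))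

-- Distances from a fixed vertex to the two ends of an edge.

data Near (m n : ℕ) : Set where
  closer  : suc m ≡ n → Near m n
  same    : m ≡ n → Near m n
  further : m ≡ suc n → Near m n

near : ∀ {m n} → m ≤ suc n → n ≤ suc m → Near m n
near {zero}  {zero}        _       _             = same refl
near {zero}  {suc zero}    _       _             = closer refl
near {zero}  {suc (suc n)} _       (s≤s ())
near {suc zero} {zero}     _       _             = further refl
near {suc (suc m)} {zero}  (s≤s ()) _
near {suc m} {suc n}       (s≤s p) (s≤s q) with near p q
... | closer e  = closer (cong suc e)
... | same e    = same (cong suc e)
... | further e = further (cong suc e)

-- The three factors involving `i` depend on `n` but not on `m`. With `n = dist x y` fixed and
-- `m = dist x z` for a neighbour `z` of `y`, they leave the sum over `z`, and each remaining factor
-- counts one kind of neighbour.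
⟦≟⟧-near : ∀ {m n} → Near m n → ∀ i →
  ⟦ m ≟ i ⟧ ≡ ⟦ suc n ≟ i ⟧ * ⟦ m ≟ suc n ⟧ + ⟦ n ≟ i ⟧ * ⟦ m ≟ n ⟧ + ⟦ n ≟ suc i ⟧ * ⟦ suc m ≟ n ⟧
⟦≟⟧-near {m} (closer refl) i
  rewrite ⟦⟧-no (m ≟ suc (suc m)) (ℕ.<⇒≢ (ℕ.m≤n⇒m≤1+n ℕ.≤-refl))
        | ⟦⟧-no (m ≟ suc m) (ℕ.<⇒≢ ℕ.≤-refl)
        | ⟦⟧-yes (suc m ≟ suc m) refl =
  lemma ⟦ suc (suc m) ≟ i ⟧ ⟦ suc m ≟ i ⟧ ⟦ m ≟ i ⟧
  where
  lemma : ∀ u v w → w ≡ u * 0ℤ + v * 0ℤ + w * 1ℤ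
  lemma = solve-∀
⟦≟⟧-near {m} (same refl) i
  rewrite ⟦⟧-no (m ≟ suc m) (ℕ.<⇒≢ ℕ.≤-refl)
        | ⟦⟧-yes (m ≟ m) refl
        | ⟦⟧-no (suc m ≟ m) (ℕ.<⇒≢ ℕ.≤-refl ∘ sym) =
  lemma ⟦ suc m ≟ i ⟧ ⟦ m ≟ i ⟧ ⟦ m ≟ suc i ⟧
  where
  lemma : ∀ u v w → v ≡ u * 0ℤ + v * 1ℤ + w * 0ℤ
  lemma = solve-∀
⟦≟⟧-near {n = n} (further refl) i
  rewrite ⟦⟧-no (suc (suc n) ≟ n) (ℕ.<⇒≢ (ℕ.m≤n⇒m≤1+n ℕ.≤-refl) ∘ sym)
        | ⟦⟧-yes (suc n ≟ suc n) refl
        | ⟦⟧-no (suc n ≟ n) (ℕ.<⇒≢ ℕ.≤-refl ∘ sym) =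
  lemma ⟦ suc n ≟ i ⟧ ⟦ n ≟ i ⟧ ⟦ n ≟ suc i ⟧
  where
  lemma : ∀ u v w → u ≡ u * 1ℤ + v * 0ℤ + w * 0ℤ
  lemma = solve-∀

-- Exactly one of the three cases of `Near` occurs, so the neighbours at equal distance can be
-- counted from the further and closer ones.
⟦≟⟧-complement : ∀ {m n} → Near m n → ⟦ m ≟ n ⟧ ≡ 1ℤ - ⟦ m ≟ suc n ⟧ - ⟦ suc m ≟ n ⟧
⟦≟⟧-complement {m} (closer refl)
  rewrite ⟦⟧-no (m ≟ suc m) (ℕ.<⇒≢ ℕ.≤-refl)
        | ⟦⟧-no (m ≟ suc (suc m)) (ℕ.<⇒≢ (ℕ.m≤n⇒m≤1+n ℕ.≤-refl))
        | ⟦⟧-yes (suc m ≟ suc m) refl = refl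
⟦≟⟧-complement {m} (same refl)
  rewrite ⟦⟧-no (m ≟ suc m) (ℕ.<⇒≢ ℕ.≤-refl)
        | ⟦⟧-yes (m ≟ m) refl
        | ⟦⟧-no (suc m ≟ m) (ℕ.<⇒≢ ℕ.≤-refl ∘ sym) = refl
⟦≟⟧-complement {n = n} (further refl)
  rewrite ⟦⟧-no (suc (suc n) ≟ n) (ℕ.<⇒≢ (ℕ.m≤n⇒m≤1+n ℕ.≤-refl) ∘ sym)
        | ⟦⟧-yes (suc n ≟ suc n) refl
        | ⟦⟧-no (suc n ≟ n) (ℕ.<⇒≢ ℕ.≤-refl ∘ sym) = refl

-- List sums and cardinalities as sums of indicators.

sum-filter : ∀ {n} {A : Set} {P : Pred A 0ℓ} (P? : Decidable P) (f : A → ℕ) (g : Fin n → A) →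
  + sum (map f (filter P? (tabulate g))) ≡ ∑[ i < n ] (⟦ P? (g i) ⟧ * + f (g i))
sum-filter {zero}  P? f g = refl
sum-filter {suc n} P? f g with P? (g zero)
... | yes _ = trans (ℤ.pos-+ (f (g zero)) _)
                (cong₂ _+_ (sym (ℤ.*-identityˡ (+ f (g zero)))) (sum-filter P? f (g ∘ suc)))
... | no _  = trans (sum-filter P? f (g ∘ suc)) (sym (ℤ.+-identityˡ _))

length≡sum-ones : {A : Set} (xs : List A) → length xs ≡ sum (map (λ _ → 1) xs)
length≡sum-ones []       = refl
length≡sum-ones (_ ∷ xs) = cong suc (length≡sum-ones xs)

card≡∑ : ∀ {N} {P : Pred (Fin N) 0ℓ} (P? : Decidable P) → + card P? ≡ ∑[ x < N ] ⟦ P? x ⟧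
card≡∑ P? = begin
  + card P?                             ≡⟨ cong +_ (length≡sum-ones (elements P?)) ⟩
  + sum (map (λ _ → 1) (elements P?))   ≡⟨ sum-filter P? (λ _ → 1) (λ x → x) ⟩
  ∑[ x < _ ] (⟦ P? x ⟧ * 1ℤ)            ≡⟨ sum-cong-≗ (λ x → ℤ.*-identityʳ ⟦ P? x ⟧) ⟩
  ∑[ x < _ ] ⟦ P? x ⟧                   ∎

card≢0 : ∀ {N} {P : Pred (Fin N) 0ℓ} (P? : Decidable P) {x} → P x → card P? ≢ 0
card≢0 P? {x} Px card≡0 with elements P? | ∈-filter⁺ P? (∈-allFin x) Px
card≢0 P? Px () | _ ∷ _ | _
card≢0 P? Px _  | []    | ()

-- Functions affine in the labeling.

module Slope {N : ℕ} (L : Fin N → ℤ) where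

  -- The slope is an index because it alone decides between constant weights and a progression, and
  -- fixes the difference of the latter.
  record HasSlope (p : ℤ) (w : Fin N → ℤ) : Set where
    constructor affine
    field
      intercept : ℤ
      equation  : ∀ x → w x ≡ p * L x + intercept

  slope-resp : ∀ {p v w} → (∀ x → v x ≡ w x) → HasSlope p w → HasSlope p v
  slope-resp v≗w (affine q eq) = affine q λ x → trans (v≗w x) (eq x)

  slope-const : ∀ {w} q → (∀ x → w x ≡ q) → HasSlope 0ℤ w
  slope-const q w≡q = affine q λ x → trans (w≡q x) (sym (ℤ.+-identityˡ q))

  slope-scale : ∀ s {p w} → HasSlope p w → HasSlope (s * p) (λ x → s * w x)
  slope-scale s {p} (affine q eq) = affine (s * q) λ x → trans (cong (s *_) (eq x)) (expand s p (L x) q)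
    where
    expand : ∀ s p l q → s * (p * l + q) ≡ s * p * l + s * q
    expand = solve-∀

  slope-∑ : ∀ {n} (p : Fin n → ℤ) (w : Fin n → Fin N → ℤ) → (∀ i → HasSlope (p i) (w i)) →
    HasSlope (∑[ i < n ] p i) (λ x → ∑[ i < n ] w i x)
  slope-∑ {zero}  p w h = slope-const 0ℤ (λ _ → refl)
  slope-∑ {suc n} p w h =
    let affine q eq = h zero
        affine r eqs = slope-∑ (p ∘ suc) (w ∘ suc) (h ∘ suc)
    in affine (q + r) λ x → trans (cong₂ _+_ (eq x) (eqs x)) (collect (p zero) (∑[ i < n ] p (suc i)) (L x) q r)
    where
    collect : ∀ p p′ l q r → p * l + q + (p′ * l + r) ≡ (p + p′) * l + (q + r)
    collect = solve-∀

  -- The slope of w is the difference of its values at the two vertices u and v,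
  -- hence an integer, although c * w is only known to have slope p.
  slope-divide : ∀ {u v} → L u ≡ 1ℤ + L v → ∀ {c p w} → c ≢ 0ℤ →
    HasSlope p (λ x → c * w x) → ∃[ p′ ] (HasSlope p′ w × c * p′ ≡ p)
  slope-divide {u} {v} Lu≡1+Lv {c} {p} {w} c≢0 (affine q eq) =
    w u - w v , affine (w v - (w u - w v) * L v) values , c*slope≡p
    where
    c*slope≡p : c * (w u - w v) ≡ p
    c*slope≡p = begin
      c * (w u - w v)                       ≡⟨ expand c (w u) (w v) ⟩
      c * w u - c * w v                     ≡⟨ cong₂ _-_ (eq u) (eq v) ⟩
      (p * L u + q) - (p * L v + q)         ≡⟨ cong (λ l → (p * l + q) - (p * L v + q)) Lu≡1+Lv ⟩
      (p * (1ℤ + L v) + q) - (p * L v + q)  ≡⟨ cancel p (L v) q ⟩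
      p                                     ∎
      where
      expand : ∀ c x y → c * (x - y) ≡ c * x - c * y
      expand = solve-∀
      cancel : ∀ p l q → (p * (1ℤ + l) + q) - (p * l + q) ≡ p
      cancel = solve-∀
    values : ∀ x → w x ≡ (w u - w v) * L x + (w v - (w u - w v) * L v)
    values x = ℤ.*-cancelˡ-≡ c _ _ {{≢-nonZero c≢0}} (begin
      c * w x                                 ≡⟨ eq x ⟩
      p * L x + q                             ≡⟨ regroup p (L x) q (L v) ⟩
      p * L x + ((p * L v + q) - p * L v)     ≡⟨ cong₂ (λ s t → s * L x + (t - s * L v)) c*slope≡p (eq v) ⟨
      c * slope * L x + (c * w v - c * slope * L v) ≡⟨ factor c slope (L x) (w v) (L v) ⟩
      c * (slope * L x + (w v - slope * L v)) ∎)
      where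
      slope = w u - w v
      regroup : ∀ p l q m → p * l + q ≡ p * l + ((p * m + q) - p * m)
      regroup = solve-∀
      factor : ∀ c s l y m → c * s * l + (c * y - c * s * m) ≡ c * (s * l + (y - s * m))
      factor = solve-∀

-- The distance function of a connected graph.

module Distance {N : ℕ} (G : ConnectedGraph N) where
  open ConnectedGraph G

  dist-walk : ∀ x y → Walk x y (dist x y)
  dist-walk x y = let n , w = connected x y in proj₁ (proj₂ (least (Walk x y) (walk? x y) n w))

  dist-minimal : ∀ {x y n} → Walk x y n → dist x y ≤ n
  dist-minimal {x} {y} w =
    let n , v = connected x y in proj₂ (proj₂ (least (Walk x y) (walk? x y) n v)) _ w

  private
    reverseOnto : ∀ {x y z m n} → Walk x y m → Walk x z n → Walk y z (m +ⁿ n)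
    reverseOnto []                  v = v
    reverseOnto {m = suc m} (a ∷ w) v = subst (Walk _ _) (ℕ.+-suc m _) (reverseOnto w (symmetric a ∷ v))

  walk-sym : ∀ {x y n} → Walk x y n → Walk y x n
  walk-sym w = subst (Walk _ _) (ℕ.+-identityʳ _) (reverseOnto w [])

  dist-sym : ∀ x y → dist x y ≡ dist y x
  dist-sym x y = ℕ.≤-antisym (dist-minimal (walk-sym (dist-walk y x)))
                             (dist-minimal (walk-sym (dist-walk x y)))

  dist-step : ∀ x {y z} → Adj y z → dist x y ≤ suc (dist x z)
  dist-step x {y} {z} a rewrite dist-sym x y | dist-sym x z = dist-minimal (a ∷ dist-walk z x)

  dist-refl : ∀ x → dist x x ≡ 0
  dist-refl x = ℕ.n≤0⇒n≡0 (dist-minimal [])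

  dist≡0⇒≡ : ∀ {x y} → dist x y ≡ 0 → x ≡ y
  dist≡0⇒≡ {x} {y} eq with [] ← subst (Walk x y) eq (dist-walk x y) = refl

  dist≡1⇒Adj : ∀ {x y} → dist x y ≡ 1 → Adj x y
  dist≡1⇒Adj {x} {y} eq with a ∷ [] ← subst (Walk x y) eq (dist-walk x y) = a

  Adj⇒dist≡1 : ∀ {x y} → Adj x y → dist x y ≡ 1
  Adj⇒dist≡1 {x} {y} a = ℕ.≤-antisym (dist-minimal (a ∷ [])) (ℕ.n≢0⇒n>0 λ eq →
    loopless (subst (Adj x) (sym (dist≡0⇒≡ eq)) a))

  -- A shortest walk from `y` to `x` starts with an edge to such a `z`, and its remainder bounds
  -- `dist x z`.
  closer-neighbour : ∀ x y {i} → dist x y ≡ suc i → ∃[ z ] (Adj y z × suc (dist x z) ≡ dist x y)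
  closer-neighbour x y eq
    with a ∷ w ← subst (Walk y x) (trans (dist-sym y x) eq) (dist-walk y x) =
    _ , a , ℕ.≤-antisym (subst (_ ≤_) (sym eq) (s≤s (dist-minimal (walk-sym w)))) (dist-step x a)

  -- Intersection numbers and the adjacency operator.

  adj : Fin N → Fin N → ℤ
  adj x y = ⟦ Adj? x y ⟧

  -- The function `a` is a parameter of its own, so that a bipartite graph can supply the zero
  -- function. The fields constrain the three functions only at attained distances.
  record IntersectionNumbers (a b c : ℕ → ℤ) : Set where
    field
      same-count    : ∀ x y → ∑[ z < N ] (adj y z * ⟦ dist x z ≟ dist x y ⟧) ≡ a (dist x y)
      further-count : ∀ x y → ∑[ z < N ] (adj y z * ⟦ dist x z ≟ suc (dist x y) ⟧) ≡ b (dist x y)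
      closer-count  : ∀ x y → ∑[ z < N ] (adj y z * ⟦ suc (dist x z) ≟ dist x y ⟧) ≡ c (dist x y)
      closer-nonzero : ∀ x y {i} → dist x y ≡ suc i → c (suc i) ≢ 0ℤ

  adj-near : ∀ x y z → Adj y z → Near (dist x z) (dist x y)
  adj-near x y z e = near (dist-step x (symmetric e)) (dist-step x e)

  neighbourSum : (Fin N → ℤ) → Fin N → ℤ
  neighbourSum w y = ∑[ z < N ] (adj y z * w z)

  module _ {a b c : ℕ → ℤ} (numbers : IntersectionNumbers a b c) where
    open IntersectionNumbers numbers

    -- This is the three-term recurrence of the distance matrices, A_i A = b_(i-1) A_(i-1) + a_i A_i
    -- + c_(i+1) A_(i+1), read at the entry (x, y).
    neighbour-count : ∀ i x y → ∑[ z < N ] (adj y z * ⟦ dist x z ≟ i ⟧) ≡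
      ⟦ suc (dist x y) ≟ i ⟧ * b (dist x y) + ⟦ dist x y ≟ i ⟧ * a (dist x y)
        + ⟦ dist x y ≟ suc i ⟧ * c (dist x y)
    neighbour-count i x y = begin
      ∑[ z < N ] (adj y z * ⟦ dist x z ≟ i ⟧)
        ≡⟨ sum-cong-≗ (λ z → trans (⟦⟧*-cong (Adj? y z) (λ e → ⟦≟⟧-near (adj-near x y z e) i))
             (regroup (adj y z) β _ α _ γ _)) ⟩
      ∑[ z < N ] (β * (adj y z * ⟦ dist x z ≟ suc (dist x y) ⟧)
        + α * (adj y z * ⟦ dist x z ≟ dist x y ⟧) + γ * (adj y z * ⟦ suc (dist x z) ≟ dist x y ⟧))
        ≡⟨ ∑-linear₃ β α γ (λ z → adj y z * ⟦ dist x z ≟ suc (dist x y) ⟧)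
             (λ z → adj y z * ⟦ dist x z ≟ dist x y ⟧) (λ z → adj y z * ⟦ suc (dist x z) ≟ dist x y ⟧) ⟩
      β * ∑[ z < N ] (adj y z * ⟦ dist x z ≟ suc (dist x y) ⟧)
        + α * ∑[ z < N ] (adj y z * ⟦ dist x z ≟ dist x y ⟧)
        + γ * ∑[ z < N ] (adj y z * ⟦ suc (dist x z) ≟ dist x y ⟧)
        ≡⟨ cong₂ _+_ (cong₂ _+_ (cong (β *_) (further-count x y)) (cong (α *_) (same-count x y)))
                     (cong (γ *_) (closer-count x y)) ⟩
      β * b (dist x y) + α * a (dist x y) + γ * c (dist x y) ∎
      where
      β α γ : ℤ
      β = ⟦ suc (dist x y) ≟ i ⟧
      α = ⟦ dist x y ≟ i ⟧
      γ = ⟦ dist x y ≟ suc i ⟧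
      regroup : ∀ e u u′ v v′ w w′ → e * (u * u′ + v * v′ + w * w′) ≡ u * (e * u′) + v * (e * v′) + w * (e * w′)
      regroup = solve-∀

  -- Sums of labels over spheres.

  module Weights (L : Fin N → ℤ) where
    open Slope L

    sphereSum : ℕ → Fin N → ℤ
    sphereSum i y = ∑[ x < N ] (⟦ dist x y ≟ i ⟧ * L x)

    -- When `g` is the indicator of a set of distances, this is the weight for that set.
    distanceSum : (ℕ → ℤ) → Fin N → ℤ
    distanceSum g y = ∑[ x < N ] (g (dist x y) * L x)

    -- Sorting the vertices by distance gives a combination of sphere sums. Slopes are assumed for
    -- the products with `g (toℕ i)`, so that a distance where `g` vanishes contributes slope 0
    -- whatever its sphere sum is.
    slope-distanceSum : ∀ {d} → (∀ x y → dist x y ≤ d) → (g : ℕ → ℤ) (p : Fin (suc d) → ℤ) →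
      (∀ i → HasSlope (p i) (λ y → g (toℕ i) * sphereSum (toℕ i) y)) →
      HasSlope (∑[ i < suc d ] p i) (distanceSum g)
    slope-distanceSum {d} dist≤d g p h = slope-resp decompose (slope-∑ p (λ i y → g (toℕ i) * sphereSum (toℕ i) y) h)
      where
      index : ∀ x y → Fin (suc d)
      index x y = fromℕ< (s≤s (dist≤d x y))
      toℕ-index : ∀ x y → toℕ (index x y) ≡ dist x y
      toℕ-index x y = toℕ-fromℕ< (s≤s (dist≤d x y))
      regroup : ∀ e g l → e * g * l ≡ g * (e * l)
      regroup = solve-∀
      term : ∀ x y → g (dist x y) * L x ≡ ∑[ i < suc d ] (g (toℕ i) * (⟦ dist x y ≟ toℕ i ⟧ * L x))
      term x y = begin
        g (dist x y) * L x
          ≡⟨ cong (λ j → g j * L x) (toℕ-index x y) ⟨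
        g (toℕ (index x y)) * L x
          -- The sum over all `i` is introduced by reading the sifting property of the indicator
          -- backwards.
          ≡⟨ cong (_* L x) (∑-δ (index x y) (λ i → g (toℕ i))) ⟨
        ∑[ i < suc d ] (⟦ index x y ≟ᶠ i ⟧ * g (toℕ i)) * L x
          ≡⟨ *-distribʳ-sum (L x) (λ i → ⟦ index x y ≟ᶠ i ⟧ * g (toℕ i)) ⟩
        ∑[ i < suc d ] (⟦ index x y ≟ᶠ i ⟧ * g (toℕ i) * L x)
          ≡⟨ sum-cong-≗ (λ i → trans (regroup ⟦ index x y ≟ᶠ i ⟧ (g (toℕ i)) (L x))
               (cong (λ e → g (toℕ i) * (e * L x)) (⟦⟧-cong (index x y ≟ᶠ i) (dist x y ≟ toℕ i)
                 (λ eq → trans (sym (toℕ-index x y)) (cong toℕ eq))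
                 (λ eq → toℕ-injective (trans (toℕ-index x y) eq))))) ⟩
        ∑[ i < suc d ] (g (toℕ i) * (⟦ dist x y ≟ toℕ i ⟧ * L x)) ∎
      decompose : ∀ y → distanceSum g y ≡ ∑[ i < suc d ] (g (toℕ i) * sphereSum (toℕ i) y)
      decompose y = begin
        distanceSum g y
          ≡⟨ sum-cong-≗ (λ x → term x y) ⟩
        ∑[ x < N ] ∑[ i < suc d ] (g (toℕ i) * (⟦ dist x y ≟ toℕ i ⟧ * L x))
          ≡⟨ ∑-comm {N} {suc d} (λ x i → g (toℕ i) * (⟦ dist x y ≟ toℕ i ⟧ * L x)) ⟩
        ∑[ i < suc d ] ∑[ x < N ] (g (toℕ i) * (⟦ dist x y ≟ toℕ i ⟧ * L x))
          ≡⟨ sum-cong-≗ {suc d} (λ i → *-distribˡ-sum (g (toℕ i)) (λ x → ⟦ dist x y ≟ toℕ i ⟧ * L x)) ⟨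
        ∑[ i < suc d ] (g (toℕ i) * sphereSum (toℕ i) y) ∎

    sphereSum-zero : ∀ y → sphereSum 0 y ≡ L y
    sphereSum-zero y = trans
      (sum-cong-≗ (λ x → cong (_* L x) (⟦⟧-cong (dist x y ≟ 0) (y ≟ᶠ x)
        (sym ∘ dist≡0⇒≡) (λ { refl → dist-refl y }))))
      (∑-δ y L)

    sphereSum-one : ∀ y → sphereSum 1 y ≡ neighbourSum L y
    sphereSum-one y = sum-cong-≗ (λ x → cong (_* L x) (⟦⟧-cong (dist x y ≟ 1) (Adj? y x)
      (symmetric ∘ dist≡1⇒Adj) (Adj⇒dist≡1 ∘ symmetric)))

    sphereSum-empty : ∀ {i} → (∀ x y → dist x y ≢ i) → ∀ y → sphereSum i y ≡ 0ℤ
    sphereSum-empty {i} empty y =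
      ∑-zero (λ x → ⟦ dist x y ≟ i ⟧ * L x) (λ x → cong (_* L x) (⟦⟧-no (dist x y ≟ i) (empty x y)))

    -- The recurrence for sphere sums.

    module _ {a b c : ℕ → ℤ} (numbers : IntersectionNumbers a b c) where
      open IntersectionNumbers numbers

      -- After the two sums are exchanged, the inner sum for a fixed `x` is a neighbour count around
      -- `y`.
      sphereSum-recurrence : ∀ i y → neighbourSum (sphereSum (suc i)) y ≡
        b i * sphereSum i y + a (suc i) * sphereSum (suc i) y + c (suc (suc i)) * sphereSum (suc (suc i)) y
      sphereSum-recurrence i y = begin
        ∑[ z < N ] (adj y z * ∑[ x < N ] (⟦ dist x z ≟ suc i ⟧ * L x))
          ≡⟨ sum-cong-≗ (λ z → *-distribˡ-sum (adj y z) (λ x → ⟦ dist x z ≟ suc i ⟧ * L x)) ⟩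
        ∑[ z < N ] ∑[ x < N ] (adj y z * (⟦ dist x z ≟ suc i ⟧ * L x))
          ≡⟨ ∑-comm (λ z x → adj y z * (⟦ dist x z ≟ suc i ⟧ * L x)) ⟩
        ∑[ x < N ] ∑[ z < N ] (adj y z * (⟦ dist x z ≟ suc i ⟧ * L x))
          ≡⟨ sum-cong-≗ inner ⟩
        ∑[ x < N ] (b i * (⟦ dist x y ≟ i ⟧ * L x) + a (suc i) * (⟦ dist x y ≟ suc i ⟧ * L x)
          + c (suc (suc i)) * (⟦ dist x y ≟ suc (suc i) ⟧ * L x))
          ≡⟨ ∑-linear₃ (b i) (a (suc i)) (c (suc (suc i))) (λ x → ⟦ dist x y ≟ i ⟧ * L x)
               (λ x → ⟦ dist x y ≟ suc i ⟧ * L x) (λ x → ⟦ dist x y ≟ suc (suc i) ⟧ * L x) ⟩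
        b i * sphereSum i y + a (suc i) * sphereSum (suc i) y + c (suc (suc i)) * sphereSum (suc (suc i)) y ∎
        where
        regroup : ∀ β b α a γ c l →
          (β * b + α * a + γ * c) * l ≡ b * (β * l) + a * (α * l) + c * (γ * l)
        regroup = solve-∀
        inner : ∀ x → ∑[ z < N ] (adj y z * (⟦ dist x z ≟ suc i ⟧ * L x)) ≡
          b i * (⟦ dist x y ≟ i ⟧ * L x) + a (suc i) * (⟦ dist x y ≟ suc i ⟧ * L x)
            + c (suc (suc i)) * (⟦ dist x y ≟ suc (suc i) ⟧ * L x)
        inner x = begin
          ∑[ z < N ] (adj y z * (⟦ dist x z ≟ suc i ⟧ * L x))
            ≡⟨ sum-cong-≗ (λ z → ℤ.*-assoc (adj y z) ⟦ dist x z ≟ suc i ⟧ (L x)) ⟨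
          ∑[ z < N ] (adj y z * ⟦ dist x z ≟ suc i ⟧ * L x)
            ≡⟨ *-distribʳ-sum (L x) (λ z → adj y z * ⟦ dist x z ≟ suc i ⟧) ⟨
          ∑[ z < N ] (adj y z * ⟦ dist x z ≟ suc i ⟧) * L x
            ≡⟨ cong (_* L x) (neighbour-count numbers (suc i) x y) ⟩
          (⟦ suc (dist x y) ≟ suc i ⟧ * b (dist x y) + ⟦ dist x y ≟ suc i ⟧ * a (dist x y)
            + ⟦ dist x y ≟ suc (suc i) ⟧ * c (dist x y)) * L x
            -- Each indicator fixes `dist x y`, which makes its coefficient independent of `x`.
            ≡⟨ cong (_* L x) (cong₂ _+_ (cong₂ _+_
                 (⟦⟧*-cong (dist x y ≟ i) (cong b))
                 (⟦⟧*-cong (dist x y ≟ suc i) (cong a)))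
                 (⟦⟧*-cong (dist x y ≟ suc (suc i)) (cong c))) ⟩
          (⟦ dist x y ≟ i ⟧ * b i + ⟦ dist x y ≟ suc i ⟧ * a (suc i)
            + ⟦ dist x y ≟ suc (suc i) ⟧ * c (suc (suc i))) * L x
            ≡⟨ regroup ⟦ dist x y ≟ i ⟧ (b i) ⟦ dist x y ≟ suc i ⟧ (a (suc i)) ⟦ dist x y ≟ suc (suc i) ⟧ (c (suc (suc i))) (L x) ⟩
          b i * (⟦ dist x y ≟ i ⟧ * L x) + a (suc i) * (⟦ dist x y ≟ suc i ⟧ * L x)
            + c (suc (suc i)) * (⟦ dist x y ≟ suc (suc i) ⟧ * L x) ∎

      -- Slopes of the sphere sums.

      module _ {k r : ℤ} (magic : ∀ y → neighbourSum L y ≡ k) (regular : ∀ y → ∑[ z < N ] adj y z ≡ r)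
               {u v : Fin N} (Lu≡1+Lv : L u ≡ 1ℤ + L v) where

        -- The adjacency operator is linear, sends `L` to the constant `k` and sends the constant 1
        -- to the degree `r`.
        neighbourSum-constant : ∀ {p w} → HasSlope p w → ∃[ q ] (∀ y → neighbourSum w y ≡ q)
        neighbourSum-constant {p} {w} (affine q eq) = p * k + q * r , λ y → begin
          ∑[ z < N ] (adj y z * w z)
            ≡⟨ sum-cong-≗ (λ z → trans (cong (adj y z *_) (eq z)) (regroup (adj y z) p (L z) q)) ⟩
          ∑[ z < N ] (p * (adj y z * L z) + q * adj y z)
            ≡⟨ ∑-linear₂ p q (λ z → adj y z * L z) (adj y) ⟩
          p * neighbourSum L y + q * ∑[ z < N ] adj y z
            ≡⟨ cong₂ (λ s t → p * s + q * t) (magic y) (regular y) ⟩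
          p * k + q * r ∎
          where
          regroup : ∀ e p l q → e * (p * l + q) ≡ p * (e * l) + q * e
          regroup = solve-∀

        -- Solving the recurrence for its last term gives a function of slope
        -- `- (b i * p + a (suc i) * p′)`, which is then divided by `c (suc (suc i))`. The last
        -- component serves the bipartite case.
        slope-step : ∀ i {p p′} → HasSlope p (sphereSum i) → HasSlope p′ (sphereSum (suc i)) →
          ∃[ p″ ] (HasSlope p″ (sphereSum (suc (suc i))) × (b i * p + a (suc i) * p′ ≡ 0ℤ → p″ ≡ 0ℤ))
        slope-step i {p} {p′} (affine q eq) h@(affine q′ eq′) with c (suc (suc i)) ℤ.≟ 0ℤ
        -- If this `c` is zero, no two vertices are at distance `suc (suc i)`, and the sphere sum is
        -- identically zero.
        ... | yes c≡0 = 0ℤ , slope-const 0ℤ (sphereSum-empty λ x y e → closer-nonzero x y e c≡0) , λ _ → refl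
        ... | no c≢0  =
          let p″ , h″ , c*p″≡ = slope-divide Lu≡1+Lv c≢0 scaled
          in p″ , h″ , λ ≡0 → ℤ.*-cancelˡ-≡ (c (suc (suc i))) p″ 0ℤ {{≢-nonZero c≢0}}
               (trans c*p″≡ (trans (cong -_ ≡0) (sym (ℤ.*-zeroʳ (c (suc (suc i)))))))
          where
          κ = proj₁ (neighbourSum-constant h)
          isolate : ∀ {n x y z} → n ≡ x + y + z → z ≡ n - x - y
          isolate {x = x} {y} {z} refl = lemma x y z
            where
            lemma : ∀ x y z → z ≡ (x + y + z) - x - y
            lemma = solve-∀
          collect : ∀ κ b p l q a p′ q′ → κ - b * (p * l + q) - a * (p′ * l + q′) ≡
            - (b * p + a * p′) * l + (κ - b * q - a * q′)
          collect = solve-∀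
          scaled : HasSlope (- (b i * p + a (suc i) * p′)) (λ y → c (suc (suc i)) * sphereSum (suc (suc i)) y)
          scaled = affine (κ - b i * q - a (suc i) * q′) λ y → begin
            c (suc (suc i)) * sphereSum (suc (suc i)) y
              ≡⟨ isolate (sphereSum-recurrence i y) ⟩
            neighbourSum (sphereSum (suc i)) y - b i * sphereSum i y - a (suc i) * sphereSum (suc i) y
              ≡⟨ cong (λ n → n - b i * sphereSum i y - a (suc i) * sphereSum (suc i) y)
                   (proj₂ (neighbourSum-constant h) y) ⟩
            κ - b i * sphereSum i y - a (suc i) * sphereSum (suc i) y
              ≡⟨ cong₂ (λ s t → κ - b i * s - a (suc i) * t) (eq y) (eq′ y) ⟩
            κ - b i * (p * L y + q) - a (suc i) * (p′ * L y + q′)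
              ≡⟨ collect κ (b i) p (L y) q (a (suc i)) p′ q′ ⟩
            - (b i * p + a (suc i) * p′) * L y + (κ - b i * q - a (suc i) * q′) ∎

        slope-zero : HasSlope 1ℤ (sphereSum 0)
        slope-zero = affine 0ℤ λ y → trans (sphereSum-zero y) (expand (L y))
          where
          expand : ∀ l → l ≡ 1ℤ * l + 0ℤ
          expand = solve-∀

        slope-one : HasSlope 0ℤ (sphereSum 1)
        slope-one = slope-const k (λ y → trans (sphereSum-one y) (magic y))

        -- Each step consumes two consecutive slopes, hence the induction carries a pair.
        slopes : ∀ i → (∃[ p ] HasSlope p (sphereSum i)) × (∃[ p ] HasSlope p (sphereSum (suc i)))
        slopes zero    = (1ℤ , slope-zero) , (0ℤ , slope-one)
        slopes (suc i) =
          let (_ , h) , (p′ , h′) = slopes i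
              p″ , h″ , _ = slope-step i h h′
          in (p′ , h′) , (p″ , h″)

        -- With `a` zero, the even sphere sum in between drops out, and slope 0 passes from one odd
        -- distance to the next. In the form `suc (n *ⁿ 2)` the index grows by two successors by
        -- computation.
        slope-odd : (∀ i → a i ≡ 0ℤ) → ∀ n → HasSlope 0ℤ (sphereSum (suc (n *ⁿ 2)))
        slope-odd a≡0 zero    = slope-one
        slope-odd a≡0 (suc n) =
          let i = suc (n *ⁿ 2)
              p′ , h′ = proj₂ (slopes i)
              p″ , h″ , p″≡0 = slope-step i (slope-odd a≡0 n) h′
          in subst (λ p → HasSlope p (sphereSum (suc (suc i))))
               (p″≡0 (cong₂ (λ s t → s + t * p′) (ℤ.*-zeroʳ (b i)) (a≡0 (suc i)))) h″

  -- Intersection numbers of a distance-regular graph.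

  module Regular {d : ℕ} (regular : DistanceRegular d) where
    private
      dist≤d = proj₁ (proj₁ regular)
      b₀ = proj₁ (proj₂ regular)
      c₀ = proj₁ (proj₂ (proj₂ regular))
      counts = proj₂ (proj₂ (proj₂ regular))

      toℕ-mod : ∀ x y → dist x y ≡ toℕ (dist x y mod suc d)
      toℕ-mod x y = sym (trans (toℕ-fromℕ< (m%n<n (dist x y) (suc d))) (m<n⇒m%n≡m (s≤s (dist≤d x y))))

    -- Only the values at i ≤ d matter; mod extends the intersection array to ℕ.
    b c : ℕ → ℤ
    b i = + b₀ (i mod suc d)
    c i = + c₀ (i mod suc d)

    private
      card-closer : ∀ x y → card (λ z → Adj? y z ×-dec (suc (dist x z) ≟ dist x y)) ≡ c₀ (dist x y mod suc d)
      card-closer x y = subst (λ j → card (λ z → Adj? y z ×-dec (suc (dist x z) ≟ j)) ≡ c₀ (dist x y mod suc d))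
        (sym (toℕ-mod x y)) (proj₁ (counts (dist x y mod suc d) x y (toℕ-mod x y)))

      card-further : ∀ x y → card (λ z → Adj? y z ×-dec (dist x z ≟ suc (dist x y))) ≡ b₀ (dist x y mod suc d)
      card-further x y = subst (λ j → card (λ z → Adj? y z ×-dec (dist x z ≟ suc j)) ≡ b₀ (dist x y mod suc d))
        (sym (toℕ-mod x y)) (proj₂ (counts (dist x y mod suc d) x y (toℕ-mod x y)))

      ∑-adj : ∀ y {P : Pred (Fin N) 0ℓ} (P? : Decidable P) →
        ∑[ z < N ] (adj y z * ⟦ P? z ⟧) ≡ + card (λ z → Adj? y z ×-dec P? z)
      ∑-adj y P? = sym (trans (card≡∑ (λ z → Adj? y z ×-dec P? z)) (sum-cong-≗ (λ z → ⟦⟧-× (Adj? y z) (P? z))))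

      closer-count : ∀ x y → ∑[ z < N ] (adj y z * ⟦ suc (dist x z) ≟ dist x y ⟧) ≡ c (dist x y)
      closer-count x y = trans (∑-adj y (λ z → suc (dist x z) ≟ dist x y)) (cong +_ (card-closer x y))

      further-count : ∀ x y → ∑[ z < N ] (adj y z * ⟦ dist x z ≟ suc (dist x y) ⟧) ≡ b (dist x y)
      further-count x y = trans (∑-adj y (λ z → dist x z ≟ suc (dist x y))) (cong +_ (card-further x y))

    -- All neighbours of `y` are at distance 1 from `y`, so the further count with both vertices
    -- equal to `y` is the degree.
    degree : ∀ y → ∑[ z < N ] adj y z ≡ b 0
    degree y = begin
      ∑[ z < N ] adj y z
        ≡⟨ sum-cong-≗ (λ z → trans (sym (ℤ.*-identityʳ (adj y z))) (⟦⟧*-cong (Adj? y z) λ e →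
             sym (⟦⟧-yes (dist y z ≟ suc (dist y y))
               (trans (Adj⇒dist≡1 e) (cong suc (sym (dist-refl y))))))) ⟩
      ∑[ z < N ] (adj y z * ⟦ dist y z ≟ suc (dist y y) ⟧)
        ≡⟨ further-count y y ⟩
      b (dist y y)
        ≡⟨ cong b (dist-refl y) ⟩
      b 0 ∎

    -- Only the count at equal distance is left open; the general and the bipartite case fill it
    -- differently.
    intersectionNumbers : ∀ {a} →
      (∀ x y → ∑[ z < N ] (adj y z * ⟦ dist x z ≟ dist x y ⟧) ≡ a (dist x y)) → IntersectionNumbers a b c
    intersectionNumbers same-count = record
      { same-count     = same-count
      ; further-count  = further-count
      ; closer-count   = closer-count
      ; closer-nonzero = λ x y eq c≡0 → let z , e , eq′ = closer-neighbour x y eq in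
          card≢0 (λ z → Adj? y z ×-dec (suc (dist x z) ≟ dist x y)) (e , eq′)
            (trans (card-closer x y) (trans (cong (λ j → c₀ (j mod suc d)) eq) (ℤ.+-injective c≡0)))
      }

    -- A neighbour that is neither further nor closer is at equal distance, so subtracting both
    -- counts from the degree `b 0` leaves this number.
    generalNumbers : IntersectionNumbers (λ i → b 0 - b i - c i) b c
    generalNumbers = intersectionNumbers λ x y → begin
      ∑[ z < N ] (adj y z * ⟦ dist x z ≟ dist x y ⟧)
        ≡⟨ sum-cong-≗ (λ z → trans (⟦⟧*-cong (Adj? y z) (λ e → ⟦≟⟧-complement (adj-near x y z e)))
             (regroup (adj y z) ⟦ dist x z ≟ suc (dist x y) ⟧ ⟦ suc (dist x z) ≟ dist x y ⟧)) ⟩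
      ∑[ z < N ] (1ℤ * adj y z + (- 1ℤ) * (adj y z * ⟦ dist x z ≟ suc (dist x y) ⟧)
        + (- 1ℤ) * (adj y z * ⟦ suc (dist x z) ≟ dist x y ⟧))
        ≡⟨ ∑-linear₃ 1ℤ (- 1ℤ) (- 1ℤ) (adj y) (λ z → adj y z * ⟦ dist x z ≟ suc (dist x y) ⟧)
             (λ z → adj y z * ⟦ suc (dist x z) ≟ dist x y ⟧) ⟩
      1ℤ * ∑[ z < N ] adj y z + (- 1ℤ) * ∑[ z < N ] (adj y z * ⟦ dist x z ≟ suc (dist x y) ⟧)
        + (- 1ℤ) * ∑[ z < N ] (adj y z * ⟦ suc (dist x z) ≟ dist x y ⟧)
        ≡⟨ cong₂ _+_ (cong₂ (λ s t → 1ℤ * s + (- 1ℤ) * t) (degree y) (further-count x y))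
             (cong ((- 1ℤ) *_) (closer-count x y)) ⟩
      1ℤ * b 0 + (- 1ℤ) * b (dist x y) + (- 1ℤ) * c (dist x y)
        ≡⟨ simplify (b 0) (b (dist x y)) (c (dist x y)) ⟩
      b 0 - b (dist x y) - c (dist x y) ∎
      where
      regroup : ∀ e u v → e * (1ℤ - u - v) ≡ 1ℤ * e + (- 1ℤ) * (e * u) + (- 1ℤ) * (e * v)
      regroup = solve-∀
      simplify : ∀ r u v → 1ℤ * r + (- 1ℤ) * u + (- 1ℤ) * v ≡ r - u - v
      simplify = solve-∀

    module _ (bipartite : Bipartite) where
      private
        side = proj₁ bipartite

        flip : ℕ → Bool → Bool
        flip zero    s = s
        flip (suc n) s = flip n (not s)

        walk-side : ∀ {x y n} → Walk x y n → side y ≡ flip n (side x)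
        walk-side []                  = refl
        walk-side {n = suc n} (e ∷ w) = trans (walk-side w) (cong (flip n) (¬-not (proj₂ bipartite (symmetric e))))

        dist-side : ∀ x y → side y ≡ flip (dist x y) (side x)
        dist-side x y = walk-side (dist-walk x y)

      -- The distance from `x` determines the side of a vertex. Adjacent vertices lie on different
      -- sides, so they are never equally far from `x`.
      bipartiteNumbers : IntersectionNumbers (λ _ → 0ℤ) b c
      bipartiteNumbers = intersectionNumbers λ x y →
        ∑-zero (λ z → adj y z * ⟦ dist x z ≟ dist x y ⟧) λ z →
          trans (⟦⟧*-cong (Adj? y z) λ e → ⟦⟧-no (dist x z ≟ dist x y) λ eq →
                  proj₂ bipartite e (trans (dist-side x y) (trans (cong (λ j → flip j (side x)) (sym eq)) (sym (dist-side x z)))))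
                (ℤ.*-zeroʳ (adj y z))

-- From slopes to magic and antimagic labelings.

toℕ+toℕ-opposite : ∀ {n} (i : Fin (suc n)) → toℕ i +ⁿ toℕ (opposite i) ≡ n
toℕ+toℕ-opposite i = trans (cong (toℕ i +ⁿ_) (opposite-prop i)) (ℕ.m+[n∸m]≡n (ℕ.≤-pred (toℕ<n i)))

module _ {N : ℕ} (G : ConnectedGraph N) (l : Labeling N) where
  open ConnectedGraph G
  open Distance G

  L : Fin N → ℤ
  L x = + label l x

  open Slope L
  open Weights L

  weight≡∑ : ∀ {D : Pred ℕ 0ℓ} (D? : Decidable D) x → + weight G l D? x ≡ ∑[ y < N ] (⟦ D? (dist x y) ⟧ * L y)
  weight≡∑ D? x = sum-filter (nbhd? D? x) (label l) (λ y → y)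

  weight≡distanceSum : ∀ {D : Pred ℕ 0ℓ} (D? : Decidable D) x →
    + weight G l D? x ≡ distanceSum (λ i → ⟦ D? i ⟧) x
  weight≡distanceSum D? x = trans (weight≡∑ D? x)
    (sum-cong-≗ (λ y → cong (λ i → ⟦ D? i ⟧ * L y) (dist-sym x y)))

  weight-one≡neighbourSum : ∀ x → + weight G l (1 ≟_) x ≡ neighbourSum L x
  weight-one≡neighbourSum x = trans (weight≡∑ (1 ≟_) x)
    (sum-cong-≗ (λ y → cong (_* L y) (⟦⟧-cong (1 ≟ dist x y) (Adj? x y) (dist≡1⇒Adj ∘ sym) (sym ∘ Adj⇒dist≡1))))

  -- The permutation `g` gives the position of each vertex in the progression: the labeling for a
  -- positive slope, its reversal for a negative one.
  progression⇒antimagic : ∀ {D : Pred ℕ 0ℓ} (D? : Decidable D) (g : Fin N → Fin N) →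
    Injective _≡_ _≡_ g → StrictlySurjective _≡_ g → ∀ α m →
    (∀ x → weight G l D? x ≡ α +ⁿ toℕ (g x) *ⁿ suc m) → Antimagic G l α (suc m) D?
  progression⇒antimagic D? g g-injective g-surjective α m eq =
    s≤s z≤n ,
    (λ {x} {y} wx≡wy → g-injective (toℕ-injective (ℕ.*-cancelʳ-≡ _ _ (suc m)
      (ℕ.+-cancelˡ-≡ α _ _ (trans (sym (eq x)) (trans wx≡wy (eq y))))))) ,
    λ v → mk⇔
      (λ { (x , refl) → g x , eq x })
      (λ { (i , refl) → let x , gx≡i = g-surjective i in
           x , trans (eq x) (cong (λ j → α +ⁿ toℕ j *ⁿ suc m) gx≡i) })

module _ {n : ℕ} (G : ConnectedGraph (suc n)) (l : Labeling (suc n)) where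
  open Slope (L G l)
  open Bijection l using (to; injective; strictlySurjective)

  slope-zero⇒magic : ∀ {D : Pred ℕ 0ℓ} (D? : Decidable D) →
    HasSlope 0ℤ (λ x → + weight G l D? x) → Magic G l D?
  slope-zero⇒magic D? (affine q eq) =
    weight G l D? zero , λ x → ℤ.+-injective (trans (eq x) (sym (eq zero)))

  slope⇒magic⊎antimagic : ∀ {D : Pred ℕ 0ℓ} (D? : Decidable D) p → HasSlope p (λ x → + weight G l D? x) →
    Magic G l D? ⊎ (∃[ α ] ∃[ δ ] Antimagic G l α δ D?)
  slope⇒magic⊎antimagic D? (+ zero) h = inj₁ (slope-zero⇒magic D? h)
  -- The smallest weight is at the vertex `v` labelled 1, so the progression starts there with the
  -- slope as difference.
  slope⇒magic⊎antimagic D? +[1+ m ] (affine q eq) = inj₂ (W v , suc m ,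
    progression⇒antimagic G l D? to injective strictlySurjective (W v) m λ x → ℤ.+-injective (begin
      + W x                                ≡⟨ eq x ⟩
      δ * (1ℤ + t x) + q                   ≡⟨ shift δ (t x) q ⟩
      (δ * 1ℤ + q) + t x * δ               ≡⟨ cong (λ j → (δ * (1ℤ + + toℕ j) + q) + t x * δ) tov≡0 ⟨
      (δ * (1ℤ + t v) + q) + t x * δ       ≡⟨ cong (_+ t x * δ) (eq v) ⟨
      + W v + t x * δ                      ≡⟨ cong (λ s → + W v + s) (ℤ.pos-* (toℕ (to x)) (suc m)) ⟨
      + (W v +ⁿ toℕ (to x) *ⁿ suc m) ∎))
    where
    W = weight G l D?
    δ = +[1+ m ]
    t : Fin (suc n) → ℤ
    t x = + toℕ (to x)
    v = proj₁ (strictlySurjective zero)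
    tov≡0 = proj₂ (strictlySurjective zero)
    shift : ∀ δ t q → δ * (1ℤ + t) + q ≡ (δ * 1ℤ + q) + t * δ
    shift = solve-∀
  -- The smallest weight is now at the vertex `v` with the largest label, and `opposite` counts
  -- positions down from it.
  slope⇒magic⊎antimagic D? -[1+ m ] (affine q eq) = inj₂ (W v , suc m ,
    progression⇒antimagic G l D? (opposite ∘ to) opposite∘to-injective opposite∘to-surjective (W v) m
      λ x → ℤ.+-injective (begin
        + W x                                          ≡⟨ eq x ⟩
        - δ * (1ℤ + t x) + q                           ≡⟨ shift δ (t x) (t′ x) q ⟩
        (- δ * (1ℤ + (t x + t′ x)) + q) + t′ x * δ     ≡⟨ cong (λ s → (- δ * (1ℤ + s) + q) + t′ x * δ) (t+t′≡tv x) ⟩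
        (- δ * (1ℤ + t v) + q) + t′ x * δ              ≡⟨ cong (_+ t′ x * δ) (eq v) ⟨
        + W v + t′ x * δ                               ≡⟨ cong (λ s → + W v + s) (ℤ.pos-* (toℕ (opposite (to x))) (suc m)) ⟨
        + (W v +ⁿ toℕ (opposite (to x)) *ⁿ suc m) ∎))
    where
    W = weight G l D?
    δ = +[1+ m ]
    t t′ : Fin (suc n) → ℤ
    t x  = + toℕ (to x)
    t′ x = + toℕ (opposite (to x))
    v = proj₁ (strictlySurjective (opposite zero))
    tov≡n : toℕ (to v) ≡ n
    tov≡n = trans (cong toℕ (proj₂ (strictlySurjective (opposite zero)))) (toℕ+toℕ-opposite {n} zero)
    t+t′≡tv : ∀ x → t x + t′ x ≡ t v
    t+t′≡tv x = cong +_ (trans (toℕ+toℕ-opposite (to x)) (sym tov≡n))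
    opposite∘to-injective : Injective _≡_ _≡_ (opposite ∘ to)
    opposite∘to-injective {x} {y} e = injective
      (trans (sym (opposite-involutive (to x))) (trans (cong opposite e) (opposite-involutive (to y))))
    opposite∘to-surjective : StrictlySurjective _≡_ (opposite ∘ to)
    opposite∘to-surjective i = let x , eq = strictlySurjective (opposite i) in
      x , trans (cong opposite eq) (opposite-involutive i)
    shift : ∀ δ t t′ q → - δ * (1ℤ + t) + q ≡ (- δ * (1ℤ + (t + t′)) + q) + t′ * δ
    shift = solve-∀

-- Weights of distance magic labelings for arbitrary sets of distances.

theorem2p6 : ∀ {N : ℕ} (G : ConnectedGraph N) (d : ℕ) →
    ConnectedGraph.DistanceRegular G d →
    (l : Labeling N) → DistanceMagic G l →
    ((D : Pred ℕ 0ℓ) (D? : Decidable D) → Satisfiable D → D ⊆ (λ i → i ≤ d) →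
    Magic G l D? ⊎ (∃[ α ] ∃[ δ ] Antimagic G l α δ D?))
    ×
    (ConnectedGraph.Bipartite G →
    (D : Pred ℕ 0ℓ) (D? : Decidable D) → Satisfiable D → D ⊆ Odd →
    Magic G l D?)
-- Without vertices constancy is vacuous, and 0 is a default constant.
theorem2p6 {zero} G d regular l magic =
  (λ _ _ _ _ → inj₁ (0 , λ ())) , (λ _ _ _ _ _ → 0 , λ ())
-- A single vertex has a single weight; the remaining clause relies on two vertices with consecutive
-- labels.
theorem2p6 {suc zero} G d regular l magic =
  (λ _ D? _ _ → inj₁ (constant D?)) , (λ _ _ D? _ _ → constant D?)
  where
  constant : ∀ {D : Pred ℕ 0ℓ} (D? : Decidable D) → Magic G l D?
  constant D? = weight G l D? zero , λ { zero → refl }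
theorem2p6 {suc (suc n)} G d regular l (k , weight≡k) =
  (λ D D? _ _ →
    -- The slope of the weight is the sum of the slopes at the distances in `D`.
    let p = λ i → ⟦ D? (toℕ i) ⟧ * proj₁ (slope (toℕ i))
    in slope⇒magic⊎antimagic G l D? _ (slope-resp (weight≡distanceSum G l D?)
         (slope-distanceSum dist≤d (λ i → ⟦ D? i ⟧) p
           (λ i → slope-scale ⟦ D? (toℕ i) ⟧ (proj₂ (slope (toℕ i))))))) ,
  (λ bipartite D D? _ D⊆Odd →
    slope-zero⇒magic G l D? (slope-resp (weight≡distanceSum G l D?)
      (subst (λ p → HasSlope p (distanceSum (λ i → ⟦ D? i ⟧)))
        (∑-zero {suc d} (λ _ → 0ℤ) (λ _ → refl))
        (slope-distanceSum dist≤d (λ i → ⟦ D? i ⟧) (λ _ → 0ℤ)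
          (λ i → odd-term bipartite D? D⊆Odd (toℕ i))))))
  where
  open Distance G
  open Regular regular
  open Slope (L G l)
  open Weights (L G l)
  open Bijection l using (strictlySurjective)

  dist≤d = proj₁ (proj₁ regular)

  neighbourSum≡k : ∀ y → neighbourSum (L G l) y ≡ + k
  neighbourSum≡k y = trans (sym (weight-one≡neighbourSum G l y)) (cong +_ (weight≡k y))

  -- These vertices carry the labels 2 and 1, a consecutive pair that keeps the divided slopes
  -- integral.
  u v : Fin (suc (suc n))
  u = proj₁ (strictlySurjective (suc zero))
  v = proj₁ (strictlySurjective zero)

  Lu≡1+Lv : L G l u ≡ 1ℤ + L G l v
  Lu≡1+Lv = trans (cong (λ j → + suc (toℕ j)) (proj₂ (strictlySurjective (suc zero))))
    (sym (cong (λ j → 1ℤ + + suc (toℕ j)) (proj₂ (strictlySurjective zero))))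

  slope : ∀ i → ∃[ p ] HasSlope p (sphereSum i)
  slope i = proj₁ (slopes generalNumbers neighbourSum≡k degree Lu≡1+Lv i)

  -- Outside `D` the indicator is 0; inside, the distance is odd and the sphere sum itself has slope
  -- 0.
  odd-term : ConnectedGraph.Bipartite G → ∀ {D : Pred ℕ 0ℓ} (D? : Decidable D) → D ⊆ Odd → ∀ i →
    HasSlope 0ℤ (λ y → ⟦ D? i ⟧ * sphereSum i y)
  odd-term bipartite D? D⊆Odd i with D? i
  ... | no _   = slope-const 0ℤ (λ _ → refl)
  ... | yes Di =
    let m , i≡1+2m = D⊆Odd Di
        i≡ = trans i≡1+2m (cong suc (ℕ.*-comm 2 m))
    in slope-resp (λ y → trans (ℤ.*-identityˡ (sphereSum i y)) (cong (λ j → sphereSum j y) i≡))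
         (slope-odd (bipartiteNumbers bipartite) neighbourSum≡k degree Lu≡1+Lv (λ _ → refl) m)
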